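{- Let $G$ be a split graph with vertex set partitioned into a clique $K$ and an independent set $I$, let $s\in K$ be the source vertex, and let $\mathcal{A}$ be the node search antimatroid of $G$ with source $s$. Then $\mathcal{A}$ has height at most two and is balanced.
   Context: The node search antimatroid of a graph $G$ with source vertex $s$ has as elements the vertices other than $s$; a set $T$ of such vertices belongs to it iff $T\cup\{s\}$ induces a connected subgraph. A basic word is an ordering of the elements such that each prefix set belongs to the antimatroid. A path of an antimatroid $\mathcal{A}$ is a set $P\in\mathcal{A}$ with exactly one $x\in P$ such that $P\setminus\{x\}\in\mathcal{A}$; the height of $\mathcal{A}$ is the height (maximum chain size) of the set of paths ordered by inclusion. For $x\ne y$, $\Pr[x<y]$ is the probability $x$ precedes $y$ in a uniformly random basic word; $\mathcal{A}$ is balanced if it has a pair with $\frac13\le\Pr[x<y]\le\frac23$ or has exactly one basic word.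
   Formalization: The graph G is additionally assumed connected; for a disconnected G (for example K = {s} and I = {v} with no edge) there is no basic word, so the probabilities are undefined and the balance claim fails. -}

module Defs where

open import Data.Nat using (ℕ; _*_; _≤_; _<_)
open import Data.Bool using (Bool; true; false)
open import Data.Fin using (Fin)
open import Data.Fin.Subset using (Subset; ⁅_⁆; _∪_; _⊆_; _⊂_; _-_; ∁; ⊥)
  renaming (_∈_ to _∈ₛ_; _∉_ to _∉ₛ_)
open import Data.List using (List; []; _∷_; _++_; take; length)
open import Data.List.Membership.Propositional using (_∈_)
open import Data.List.Relation.Unary.Unique.Propositional using (Unique)
open import Data.Product using (Σ; ∃; ∃-syntax; _×_; _,_)
open import Data.Sum using (_⊎_)
open import Relation.Binary.PropositionalEquality using (_≡_; _≢_)
open import Relation.Nullary using (¬_)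
open import Function.Bundles using (_⇔_)

record Graph (n : ℕ) : Set where
  field
    adj   : Fin n → Fin n → Bool
    sym   : ∀ u v → adj u v ≡ adj v u
    irref : ∀ v → adj v v ≡ false

module _ {n : ℕ} (G : Graph n) where
  open Graph G

  Adj : Fin n → Fin n → Set
  Adj u v = adj u v ≡ true

  data WalkIn (S : Subset n) : Fin n → Fin n → Set where
    here : ∀ {u} → u ∈ₛ S → WalkIn S u u
    step : ∀ {u v w} → u ∈ₛ S → Adj u v → WalkIn S v w → WalkIn S u w

  InducedConnected : Subset n → Set
  InducedConnected S = ∀ u v → u ∈ₛ S → v ∈ₛ S → WalkIn S u v

  Connected : Set
  Connected = ∀ (u v : Fin n) → WalkIn (∁ ⊥) u v

  IsSplitPartition : Subset n → Set
  IsSplitPartition K =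
    (∀ u v → u ∈ₛ K → v ∈ₛ K → u ≢ v → Adj u v) ×
    (∀ u v → u ∉ₛ K → v ∉ₛ K → ¬ Adj u v)

-- Set systems (antimatroids) on a ground set E ⊆ Fin n, given by
-- their family of feasible sets F.

listSet : {n : ℕ} → List (Fin n) → Subset n
listSet []       = ⊥
listSet (x ∷ xs) = ⁅ x ⁆ ∪ listSet xs

module _ {n : ℕ} (E : Subset n) (F : Subset n → Set) where

  IsPath : Subset n → Set
  IsPath P = F P × ∃[ x ] (x ∈ₛ P × F (P - x) × (∀ y → y ∈ₛ P → F (P - y) → y ≡ x))

  HeightAtMostTwo : Set
  HeightAtMostTwo = ¬ (∃[ P₁ ] ∃[ P₂ ] ∃[ P₃ ]
    (IsPath P₁ × IsPath P₂ × IsPath P₃ × P₁ ⊂ P₂ × P₂ ⊂ P₃))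

  BasicWord : List (Fin n) → Set
  BasicWord w = Unique w × (∀ x → (x ∈ w) ⇔ (x ∈ₛ E)) × (∀ k → F (listSet (take k w)))

  Precedes : Fin n → Fin n → List (Fin n) → Set
  Precedes x y w = ∃[ a ] ∃[ b ] (w ≡ a ++ (x ∷ b) × y ∈ b)

  Enumerates : (List (Fin n) → Set) → List (List (Fin n)) → Set
  Enumerates P L = Unique L × (∀ w → (w ∈ L) ⇔ P w)

  -- 1/3 ≤ Pr[x < y] ≤ 2/3 for a uniformly random basic word,
  -- with Pr[x<y] = #{basic words with x before y} / #{basic words}
  BalancedPair : Fin n → Fin n → Set
  BalancedPair x y =
    ∃[ L ] ∃[ L' ] (Enumerates BasicWord L ×
                    Enumerates (λ w → BasicWord w × Precedes x y w) L' ×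
                    0 < length L ×
                    length L ≤ 3 * length L' × 3 * length L' ≤ 2 * length L)

  ExactlyOneBasicWord : Set
  ExactlyOneBasicWord = ∃[ w ] (BasicWord w × (∀ w' → BasicWord w' → w' ≡ w))

  Balanced : Set
  Balanced = (∃[ x ] ∃[ y ] (x ≢ y × x ∈ₛ E × y ∈ₛ E × BalancedPair x y))
             ⊎ ExactlyOneBasicWord

module _ {n : ℕ} (G : Graph n) (s : Fin n) where

  NSGround : Subset n
  NSGround = ∁ ⁅ s ⁆

  NSFeasible : Subset n → Set
  NSFeasible T = T ⊆ NSGround × InducedConnected G (T ∪ ⁅ s ⁆)

{-# OPTIONS --safe #-}
module Submission where

-- Call a vertex free if it is adjacent to s and dependent otherwise.  Since s ∈ K, a set is
-- feasible iff each of its dependent vertices has a free neighbour in it, so a path is either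
-- a free vertex or a dependent vertex with one free neighbour.
--
-- For balance, count words by injections that relabel a word by an involution.  Let y, y′ be
-- dependent with a common free neighbour k.  Exchanging y and y′ after k has been visited gives
-- #(k < y < y′) ≤ #(y′ < y), hence #(k < y) ≤ 2 #(y′ < y); exchanging y and k gives
-- #(y < k) ≤ #(k < y).  If y′ < y is the less likely order, it follows that (k , y) or (y , y′)
-- is balanced.  Otherwise the neighbourhoods of dependent vertices are disjoint, so two free
-- neighbours of one dependent vertex, and likewise two dependent vertices with one neighbour
-- each, are exchanged by an automorphism.  What remains is at most one dependent vertex y, with
-- a single neighbour k.  Without y any two vertices are exchangeable; with y, a further vertex i
-- satisfies 1/3 ≤ Pr[i < k] ≤ 1/2; in the other cases there is only one word.

open import Defs
open import Data.Nat using (ℕ; zero; suc; _+_; _*_; _≤_; _<_; z≤n; s≤s; s≤s⁻¹)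
open import Data.Nat.Properties as ℕ using (_<?_; _≤?_)
open import Data.Bool using (true)
import Data.Bool.Properties as Bool
open import Data.Fin using (Fin; suc)
open import Data.Fin.Properties using (_≟_; any?; all?)
open import Data.Fin.Subset using (Subset; _∈_; _∉_; _∪_; _-_; ⁅_⁆)
open import Data.Fin.Subset.Properties using (x∈p∪q⁺; x∈p∪q⁻; x∈⁅x⁆; x∈⁅y⁆⇒x≡y; x∈∁p⇒x∉p; x∉p⇒x∈∁p; x≢y⇒x∉⁅y⁆; x∉⁅y⁆⇒x≢y; p─q⊆p; x∈p∧x≢y⇒x∈p-y; ∉⊥; _∈?_)
open import Data.List using (List; []; _∷_; _++_; map; filter; take; length; allFin; cartesianProductWith)
open import Data.List.Properties using (length-++; length-map; length-tabulate; map-injective; ∷-injective)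
import Data.List.Membership.Propositional as L
open import Data.List.Membership.Propositional.Properties using (∈-++⁺ˡ; ∈-++⁺ʳ; ∈-++⁻; ∈-∃++; ∈-map⁺; ∈-map⁻; ∈-filter⁺; ∈-filter⁻; ∈-allFin; ∈-cartesianProductWith⁺; ∈-cartesianProductWith⁻; ∈-length)
import Data.List.Membership.DecPropositional as DecMembership
open import Data.List.Relation.Unary.Any using (here; there)
open import Data.List.Relation.Unary.All using ([])
open import Data.List.Relation.Unary.All.Properties using (All¬⇒¬Any; ¬Any⇒All¬)
open import Data.List.Relation.Unary.AllPairs using ([]; _∷_)
open import Data.List.Relation.Unary.Unique.Propositional using (Unique)
open import Data.List.Relation.Unary.Unique.Propositional.Properties using (map⁺; ++⁺; filter⁺; allFin⁺; cartesianProductWith⁺)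
open import Data.List.Relation.Unary.Unique.DecPropositional using (unique?)
open import Data.Vec using (_∷_; there)
open import Data.Empty using (⊥)
open import Data.Product using (∃; ∃-syntax; _×_; _,_; proj₁; proj₂)
open import Data.Sum as Sum using (_⊎_; inj₁; inj₂; [_,_]′)
open import Function using (_∘_; id)
open import Function.Bundles using (mk⇔; Equivalence)
open import Relation.Binary.Definitions using (tri<; tri≈; tri>)
open import Relation.Binary.PropositionalEquality using (_≡_; _≢_; refl; sym; trans; cong; subst; subst₂)
open import Relation.Nullary using (¬_; Dec; yes; no; contradiction)
open import Relation.Nullary.Decidable using (_×-dec_; _⊎-dec_; _→-dec_; ¬?; map′; decidable-stable)
open import Relation.Unary using (Decidable)

open Equivalence using (to; from)

-- Counting in lists: pigeonhole, covers, partitions and injections.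

unique-⊆⇒length≤ : {A : Set} {xs ys : List A} → Unique xs →
                   (∀ {x} → x L.∈ xs → x L.∈ ys) → length xs ≤ length ys
unique-⊆⇒length≤ [] _ = z≤n
unique-⊆⇒length≤ {xs = x ∷ xs} {ys} (x∉xs ∷ xs!) xs⊆ys with ∈-∃++ (xs⊆ys (here refl))
... | as , bs , refl = begin
  suc (length xs)             ≤⟨ s≤s (unique-⊆⇒length≤ xs! xs⊆as++bs) ⟩
  suc (length (as ++ bs))     ≡⟨ cong suc (length-++ as) ⟩
  suc (length as + length bs) ≡⟨ ℕ.+-suc (length as) (length bs) ⟨
  length as + suc (length bs) ≡⟨ length-++ as ⟨
  length (as ++ x ∷ bs)       ∎
  where
  open ℕ.≤-Reasoning
  xs⊆as++bs : ∀ {z} → z L.∈ xs → z L.∈ as ++ bs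
  xs⊆as++bs z∈xs with ∈-++⁻ as (xs⊆ys (there z∈xs))
  ... | inj₁ z∈as         = ∈-++⁺ˡ z∈as
  ... | inj₂ (here refl)  = contradiction z∈xs (All¬⇒¬Any x∉xs)
  ... | inj₂ (there z∈bs) = ∈-++⁺ʳ as z∈bs

module _ {A : Set} where

  count : {P : A → Set} → Decidable P → List A → ℕ
  count P? xs = length (filter P? xs)

  module _ {P Q R : A → Set} (P? : Decidable P) (Q? : Decidable Q) (R? : Decidable R) where

    count-cover : ∀ xs → (∀ {x} → x L.∈ xs → P x → Q x ⊎ R x) →
                  count P? xs ≤ count Q? xs + count R? xs
    count-cover []       _ = z≤n
    count-cover (x ∷ xs) P⇒Q⊎R with count-cover xs (P⇒Q⊎R ∘ there) | P? x | Q? x | R? x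
    ... | ih | no _   | no _   | no _   = ih
    ... | ih | no _   | yes _  | no _   = ℕ.m≤n⇒m≤1+n ih
    ... | ih | no _   | no _   | yes _  = ℕ.≤-trans ih (ℕ.+-monoʳ-≤ (count Q? xs) (ℕ.n≤1+n _))
    ... | ih | no _   | yes _  | yes _  = ℕ.m≤n⇒m≤1+n (ℕ.≤-trans ih (ℕ.+-monoʳ-≤ (count Q? xs) (ℕ.n≤1+n _)))
    ... | ih | yes _  | yes _  | no _   = s≤s ih
    ... | ih | yes _  | yes _  | yes _  = s≤s (ℕ.≤-trans ih (ℕ.+-monoʳ-≤ (count Q? xs) (ℕ.n≤1+n _)))
    ... | ih | yes _  | no _   | yes _  = ℕ.≤-trans (s≤s ih) (ℕ.≤-reflexive (sym (ℕ.+-suc (count Q? xs) _)))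
    ... | ih | yes px | no ¬qx | no ¬rx = contradiction (P⇒Q⊎R (here refl) px) [ ¬qx , ¬rx ]′

  module _ {P Q : A → Set} (P? : Decidable P) (Q? : Decidable Q) where

    count-partition : ∀ xs → (∀ {x} → x L.∈ xs → P x ⊎ Q x) → (∀ {x} → P x → ¬ Q x) →
                      length xs ≡ count P? xs + count Q? xs
    count-partition []       _   _    = refl
    count-partition (x ∷ xs) P⊎Q P⇒¬Q with count-partition xs (P⊎Q ∘ there) P⇒¬Q | P? x | Q? x
    ... | ih | yes px | yes qx = contradiction qx (P⇒¬Q px)
    ... | ih | yes _  | no _   = cong suc ih
    ... | ih | no _   | yes _  = trans (cong suc ih) (sym (ℕ.+-suc (count P? xs) _))
    ... | ih | no ¬px | no ¬qx = contradiction (P⊎Q (here refl)) [ ¬px , ¬qx ]′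

    -- The images of the elements satisfying `P` are distinct and lie in the list filtered by `Q`.
    -- Membership of `f x` in `xs` is asked for only under `P x`, because a relabelled word need not
    -- be a word in general.
    count-inject : ∀ {xs} (f : A → A) → (∀ {x y} → f x ≡ f y → x ≡ y) → Unique xs →
                   (∀ {x} → x L.∈ xs → P x → f x L.∈ xs × Q (f x)) →
                   count P? xs ≤ count Q? xs
    count-inject {xs} f f-inj xs! P⇒Qf =
      subst (_≤ count Q? xs) (length-map f (filter P? xs))
        (unique-⊆⇒length≤ (map⁺ f-inj (filter⁺ P? xs!)) image)
      where
      image : ∀ {z} → z L.∈ map f (filter P? xs) → z L.∈ filter Q? xs
      image z∈ with ∈-map⁻ f z∈
      ... | x , x∈ , refl with ∈-filter⁻ P? x∈
      ...   | x∈xs , px with P⇒Qf x∈xs px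
      ...     | fx∈xs , qfx = ∈-filter⁺ Q? fx∈xs qfx

-- Duplicate-free lists over `Fin n`: enumeration, positions and order of occurrence.

module _ {n : ℕ} where

  -- A finite universe for enumeration: a duplicate-free list over `Fin n` has length at most `n`,
  -- so filtering `boundedLists n` yields all words.
  boundedLists : ℕ → List (List (Fin n))
  boundedLists zero    = [] ∷ []
  boundedLists (suc m) = [] ∷ cartesianProductWith _∷_ (allFin n) (boundedLists m)

  boundedLists-unique : ∀ m → Unique (boundedLists m)
  boundedLists-unique zero    = [] ∷ []
  boundedLists-unique (suc m) =
    ¬Any⇒All¬ _ []∉ ∷ cartesianProductWith⁺ _∷_ ∷-injective (allFin⁺ n) (boundedLists-unique m)
    where
    []∉ : ¬ ([] L.∈ cartesianProductWith _∷_ (allFin n) (boundedLists m))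
    []∉ []∈ with ∈-cartesianProductWith⁻ _∷_ (allFin n) (boundedLists m) []∈
    ... | _ , _ , _ , _ , ()

  ∈-boundedLists : ∀ m w → length w ≤ m → w L.∈ boundedLists m
  ∈-boundedLists zero    []      _         = here refl
  ∈-boundedLists (suc m) []      _         = here refl
  ∈-boundedLists (suc m) (x ∷ w) (s≤s w≤m) =
    there (∈-cartesianProductWith⁺ _∷_ (∈-allFin x) (∈-boundedLists m w w≤m))

  unique-∈-boundedLists : ∀ {w} → Unique w → w L.∈ boundedLists n
  unique-∈-boundedLists {w} w! = ∈-boundedLists n w
    (subst (length w ≤_) (length-tabulate id) (unique-⊆⇒length≤ w! (λ {x} _ → ∈-allFin x)))

  -- Index of the first occurrence, and the length of the list if there is none.
  pos : Fin n → List (Fin n) → ℕ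
  pos x []      = zero
  pos x (y ∷ w) with x ≟ y
  ... | yes _ = zero
  ... | no  _ = suc (pos x w)

  pos-head : ∀ x w → pos x (x ∷ w) ≡ 0
  pos-head x w with x ≟ x
  ... | yes _  = refl
  ... | no x≢x = contradiction refl x≢x

  pos-tail : ∀ {x y} w → x ≢ y → pos x (y ∷ w) ≡ suc (pos x w)
  pos-tail {x} {y} w x≢y with x ≟ y
  ... | yes x≡y = contradiction x≡y x≢y
  ... | no  _   = refl

  pos-map : ∀ {f : Fin n → Fin n} → (∀ {x y} → f x ≡ f y → x ≡ y) →
            ∀ x w → pos (f x) (map f w) ≡ pos x w
  pos-map f-inj x []      = refl
  pos-map {f} f-inj x (y ∷ w) with x ≟ y | f x ≟ f y
  ... | yes _   | yes _   = refl
  ... | no  _   | no  _   = cong suc (pos-map f-inj x w)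
  ... | yes x≡y | no fx≢fy = contradiction (cong f x≡y) fx≢fy
  ... | no  x≢y | yes fx≡fy = contradiction (f-inj fx≡fy) x≢y

  pos-injective : ∀ {x y w} → x L.∈ w → pos x w ≡ pos y w → x ≡ y
  pos-injective {x} {y} {z ∷ w} x∈ eq with x ≟ z | y ≟ z
  ... | yes x≡z | yes y≡z = trans x≡z (sym y≡z)
  pos-injective (here x≡z) eq | no x≢z | no _ = contradiction x≡z x≢z
  pos-injective (there x∈) eq | no x≢z | no _ = pos-injective x∈ (ℕ.suc-injective eq)

  ∈-take⇒pos< : ∀ {x} k w → x L.∈ take k w → pos x w < k
  ∈-take⇒pos< {x} (suc k) (y ∷ w) x∈ with x ≟ y
  ∈-take⇒pos< (suc k) (y ∷ w) x∈         | yes _  = s≤s z≤n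
  ∈-take⇒pos< (suc k) (y ∷ w) (here x≡y) | no x≢y = contradiction x≡y x≢y
  ∈-take⇒pos< (suc k) (y ∷ w) (there x∈) | no _   = s≤s (∈-take⇒pos< k w x∈)

  pos<⇒∈-take : ∀ {x} k w → x L.∈ w → pos x w < k → x L.∈ take k w
  pos<⇒∈-take {x} (suc k) (y ∷ w) x∈ lt with x ≟ y
  pos<⇒∈-take (suc k) (y ∷ w) x∈         lt       | yes x≡y = here x≡y
  pos<⇒∈-take (suc k) (y ∷ w) (here x≡y) lt       | no x≢y  = contradiction x≡y x≢y
  pos<⇒∈-take (suc k) (y ∷ w) (there x∈) (s≤s lt) | no _    = there (pos<⇒∈-take k w x∈ lt)

  ∈-take⇒∈ : ∀ {x : Fin n} k w → x L.∈ take k w → x L.∈ w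
  ∈-take⇒∈ (suc k) (y ∷ w) (here x≡y) = here x≡y
  ∈-take⇒∈ (suc k) (y ∷ w) (there x∈) = there (∈-take⇒∈ k w x∈)

  pos-++ˡ : ∀ {x} as bs → x L.∈ as → pos x (as ++ bs) < length as
  pos-++ˡ {x} (a ∷ as) bs x∈ with x ≟ a
  pos-++ˡ (a ∷ as) bs x∈         | yes _  = s≤s z≤n
  pos-++ˡ (a ∷ as) bs (here x≡a) | no x≢a = contradiction x≡a x≢a
  pos-++ˡ (a ∷ as) bs (there x∈) | no _   = s≤s (pos-++ˡ as bs x∈)

  pos-++ʳ : ∀ {x} as bs → ¬ (x L.∈ as) → length as ≤ pos x (as ++ bs)
  pos-++ʳ []       bs x∉ = z≤n
  pos-++ʳ {x} (a ∷ as) bs x∉ with x ≟ a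
  ... | yes x≡a = contradiction (here x≡a) x∉
  ... | no  _   = s≤s (pos-++ʳ as bs (x∉ ∘ there))

  pos<⇒split : ∀ {x y} w → y L.∈ w → pos x w < pos y w →
               ∃[ a ] ∃[ b ] (w ≡ a ++ (x ∷ b) × y L.∈ b)
  pos<⇒split {x} {y} (z ∷ w) y∈ lt with x ≟ z | y ≟ z
  pos<⇒split (z ∷ w) (here y≡z) lt | yes refl | no y≢z = contradiction y≡z y≢z
  pos<⇒split (z ∷ w) (there y∈) lt | yes refl | no _   = [] , w , refl , y∈
  pos<⇒split (z ∷ w) (here y≡z) lt | no _     | no y≢z = contradiction y≡z y≢z
  pos<⇒split (z ∷ w) (there y∈) (s≤s lt) | no _ | no _ with pos<⇒split w y∈ lt
  ... | a , b , refl , y∈b = z ∷ a , b , refl , y∈b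

  split⇒pos< : ∀ {x y} a b → Unique (a ++ (x ∷ b)) → y L.∈ b →
               pos x (a ++ (x ∷ b)) < pos y (a ++ (x ∷ b))
  split⇒pos< {x} {y} [] b (x∉b ∷ _) y∈b
    rewrite pos-head x b | pos-tail {y} {x} b (λ { refl → All¬⇒¬Any x∉b y∈b }) = s≤s z≤n
  split⇒pos< {x} {y} (z ∷ a) b (z∉ ∷ w!) y∈b
    rewrite pos-tail {x} {z} (a ++ x ∷ b) (λ { refl → All¬⇒¬Any z∉ (∈-++⁺ʳ a (here refl)) })
          | pos-tail {y} {z} (a ++ x ∷ b) (λ { refl → All¬⇒¬Any z∉ (∈-++⁺ʳ a (there y∈b)) }) =
    s≤s (split⇒pos< a b w! y∈b)

  ∈-listSet⁺ : ∀ {x} {w : List (Fin n)} → x L.∈ w → x ∈ listSet w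
  ∈-listSet⁺ (here refl) = x∈p∪q⁺ (inj₁ (x∈⁅x⁆ _))
  ∈-listSet⁺ (there x∈w) = x∈p∪q⁺ (inj₂ (∈-listSet⁺ x∈w))

  ∈-listSet⁻ : ∀ {x} (w : List (Fin n)) → x ∈ listSet w → x L.∈ w
  ∈-listSet⁻ []      x∈ = contradiction x∈ ∉⊥
  ∈-listSet⁻ (y ∷ w) x∈ with x∈p∪q⁻ ⁅ y ⁆ (listSet w) x∈
  ... | inj₁ x∈⁅y⁆ = here (x∈⁅y⁆⇒x≡y y x∈⁅y⁆)
  ... | inj₂ x∈w   = there (∈-listSet⁻ w x∈w)

  abstract

    swap : Fin n → Fin n → Fin n → Fin n
    swap a b x with x ≟ a | x ≟ b
    ... | yes _ | _     = b
    ... | no _  | yes _ = a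
    ... | no _  | no _  = x

    swap-left : ∀ a b → swap a b a ≡ b
    swap-left a b with a ≟ a | a ≟ b
    ... | yes _  | _ = refl
    ... | no a≢a | _ = contradiction refl a≢a

    swap-right : ∀ a b → swap a b b ≡ a
    swap-right a b with b ≟ a | b ≟ b
    ... | yes b≡a | _      = b≡a
    ... | no _    | yes _  = refl
    ... | no _    | no b≢b = contradiction refl b≢b

    swap-other : ∀ {a b x} → x ≢ a → x ≢ b → swap a b x ≡ x
    swap-other {a} {b} {x} x≢a x≢b with x ≟ a | x ≟ b
    ... | yes x≡a | _       = contradiction x≡a x≢a
    ... | no _    | yes x≡b = contradiction x≡b x≢b
    ... | no _    | no _    = refl

    swap-involutive : ∀ a b x → swap a b (swap a b x) ≡ x
    swap-involutive a b x with x ≟ a | x ≟ b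
    ... | yes refl | _        = swap-right x b
    ... | no _     | yes refl = swap-left a x
    ... | no x≢a   | no x≢b   = swap-other x≢a x≢b

    swap-preserves : (P : Fin n → Set) → ∀ {a b} → P a → P b → ∀ {x} → P x → P (swap a b x)
    swap-preserves P {a} {b} pa pb {x} px with x ≟ a | x ≟ b
    ... | yes _ | _     = pb
    ... | no _  | yes _ = pa
    ... | no _  | no _  = px

  -- A record rather than a bare inequality, so that `x`, `y` and `w` can be inferred from the type.
  record Before (x y : Fin n) (w : List (Fin n)) : Set where
    constructor before
    field pos< : pos x w < pos y w

  open Before public

  before? : ∀ x y → Decidable (Before x y)
  before? x y w = map′ before pos< (pos x w <? pos y w)

  before-trans : ∀ {x y z w} → Before x y w → Before y z w → Before x z w
  before-trans (before x<y) (before y<z) = before (ℕ.<-trans x<y y<z)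

  before-asym : ∀ {x y w} → Before x y w → ¬ Before y x w
  before-asym (before x<y) (before y<x) = ℕ.<-asym x<y y<x

  before-total : ∀ {x y w} → x ≢ y → x L.∈ w → Before x y w ⊎ Before y x w
  before-total {x} {y} {w} x≢y x∈w with ℕ.<-cmp (pos x w) (pos y w)
  ... | tri< lt _ _ = inj₁ (before lt)
  ... | tri≈ _ eq _ = contradiction (pos-injective x∈w eq) x≢y
  ... | tri> _ _ gt = inj₂ (before gt)

  before-cong : ∀ {w x y p q} → x ≡ p → y ≡ q → Before p q w → Before x y w
  before-cong refl refl lt = lt

  before-tail : ∀ {x y z w} → x ≢ z → y ≢ z → Before x y w → Before x y (z ∷ w)
  before-tail {w = w} x≢z y≢z (before lt) =
    before (subst₂ _<_ (sym (pos-tail w x≢z)) (sym (pos-tail w y≢z)) (s≤s lt))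

  before-untail : ∀ {x y z w} → x ≢ z → y ≢ z → Before x y (z ∷ w) → Before x y w
  before-untail {w = w} x≢z y≢z (before lt) =
    before (s≤s⁻¹ (subst₂ _<_ (pos-tail w x≢z) (pos-tail w y≢z) lt))

  -- The head of `v` precedes every other entry of `v`, hence also in `w`; were the head of `w`
  -- different, something would precede position 0. Equal heads can be removed, and the tails
  -- satisfy the same hypotheses.
  unique-order-determines : ∀ {v w} → Unique v → Unique w →
    (∀ {x} → x L.∈ v → x L.∈ w) → (∀ {x} → x L.∈ w → x L.∈ v) →
    (∀ {x y} → x L.∈ v → y L.∈ v → Before x y v → Before x y w) → v ≡ w
  unique-order-determines {[]}    {[]}    _ _ _ _ _ = refl
  unique-order-determines {[]}    {y ∷ w} _ _ _ w⊆v _ with () ← w⊆v (here refl)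
  unique-order-determines {x ∷ v} {[]}    _ _ v⊆w _ _ with () ← v⊆w (here refl)
  unique-order-determines {x ∷ v} {y ∷ w} (x∉v ∷ v!) (y∉w ∷ w!) v⊆w w⊆v mono with x ≟ y
  ... | yes refl = cong (x ∷_) (unique-order-determines v! w! v⊆w′ w⊆v′ mono′)
    where
    ≢v : ∀ {z} → z L.∈ v → z ≢ x
    ≢v z∈v refl = All¬⇒¬Any x∉v z∈v
    v⊆w′ : ∀ {z} → z L.∈ v → z L.∈ w
    v⊆w′ z∈v with v⊆w (there z∈v)
    ... | here refl = contradiction z∈v (All¬⇒¬Any x∉v)
    ... | there z∈w = z∈w
    w⊆v′ : ∀ {z} → z L.∈ w → z L.∈ v
    w⊆v′ z∈w with w⊆v (there z∈w)
    ... | here refl = contradiction z∈w (All¬⇒¬Any y∉w)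
    ... | there z∈v = z∈v
    mono′ : ∀ {a b} → a L.∈ v → b L.∈ v → Before a b v → Before a b w
    mono′ a∈ b∈ a<b = before-untail (≢v a∈) (≢v b∈)
      (mono (there a∈) (there b∈) (before-tail (≢v a∈) (≢v b∈) a<b))
  ... | no x≢y = contradiction
    (subst (pos x (y ∷ w) <_) (pos-head y w)
      (pos< (mono (here refl) (w⊆v (here refl)) (before
        (subst₂ _<_ (sym (pos-head x v)) (sym (pos-tail v (x≢y ∘ sym))) (s≤s z≤n))))))
    λ ()

-- Used with `p` and `q` counting the two orders of `y` and `y′`, and `r` and `r′` those of `k` and
-- `y`. Since `2 * r′ ≤ r ≤ 2 * p`, twice the total is at most `3 * r`, hence at most `6 * p`.
balanced-arith : ∀ p q r r′ → p + q ≡ r + r′ → r ≤ 2 * p → 2 * r′ ≤ r → q ≤ 2 * p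
balanced-arith p q r r′ p+q≡r+r′ r≤2p 2r′≤r = ℕ.*-cancelˡ-≤ 2 (ℕ.+-cancelˡ-≤ (2 * p) _ _ (begin
  2 * p + 2 * q       ≡⟨ ℕ.*-distribˡ-+ 2 p q ⟨
  2 * (p + q)         ≡⟨ cong (2 *_) p+q≡r+r′ ⟩
  2 * (r + r′)        ≡⟨ ℕ.*-distribˡ-+ 2 r r′ ⟩
  2 * r + 2 * r′      ≤⟨ ℕ.+-monoʳ-≤ (2 * r) 2r′≤r ⟩
  2 * r + r           ≤⟨ ℕ.+-mono-≤ (ℕ.*-monoʳ-≤ 2 r≤2p) r≤2p ⟩
  2 * (2 * p) + 2 * p ≡⟨ ℕ.+-comm (2 * (2 * p)) (2 * p) ⟩
  2 * p + 2 * (2 * p) ∎))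
  where open ℕ.≤-Reasoning

m≤n⇒m≤2*n : ∀ {m n} → m ≤ n → m ≤ 2 * n
m≤n⇒m≤2*n m≤n = ℕ.≤-trans m≤n (ℕ.m≤m+n _ _)

-- Words in which every dependent vertex follows one of its free neighbours.

module Words {n : ℕ} (s : Fin n) (Free : Fin n → Set) (N : Fin n → Fin n → Set)
  (free? : Decidable Free) (N? : ∀ y u → Dec (N y u))
  (¬free-s : ¬ Free s) (N⇒free : ∀ {y u} → N y u → Free u)
  (hasNeighbour : ∀ {y} → y ≢ s → ¬ Free y → ∃ (N y)) where

  open DecMembership (_≟_ {n}) using () renaming (_∈?_ to _∈ˡ?_)

  Dependent : Fin n → Set
  Dependent y = y ≢ s × ¬ Free y

  dependent? : Decidable Dependent
  dependent? y = ¬? (y ≟ s) ×-dec ¬? (free? y)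

  free≢s : ∀ {x} → Free x → x ≢ s
  free≢s fx refl = ¬free-s fx

  free≢dependent : ∀ {x y} → Free x → Dependent y → x ≢ y
  free≢dependent fx (_ , ¬fy) refl = ¬fy fx

  Supported : Fin n → List (Fin n) → Set
  Supported y w = Free y ⊎ ∃[ u ] (N y u × Before u y w)

  -- Feasibility of all prefixes restated as a decidable condition on positions. As supports are
  -- free, one earlier neighbour suffices and no chain has to be followed.
  Good : List (Fin n) → Set
  Good w = Unique w × (∀ x → (x L.∈ w → x ≢ s) × (x ≢ s → x L.∈ w)) ×
           (∀ y → y ≢ s → Supported y w)

  good? : Decidable Good
  good? w = unique? _≟_ w
    ×-dec all? (λ x → ((x ∈ˡ? w) →-dec ¬? (x ≟ s)) ×-dec (¬? (x ≟ s) →-dec (x ∈ˡ? w)))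
    ×-dec all? (λ y → ¬? (y ≟ s) →-dec (free? y ⊎-dec any? (λ u → N? y u ×-dec before? u y w)))

  good-∈ : ∀ {w x} → Good w → x ≢ s → x L.∈ w
  good-∈ (_ , mem , _) = proj₂ (mem _)

  good-support : ∀ {w y} → Good w → Dependent y → ∃[ u ] (N y u × Before u y w)
  good-support (_ , _ , supp) (y≢s , ¬fy) = [ (λ fy → contradiction fy ¬fy) , id ]′ (supp _ y≢s)

  words : List (List (Fin n))
  words = filter good? (boundedLists n)

  words-unique : Unique words
  words-unique = filter⁺ good? (boundedLists-unique n)

  ∈-words⁺ : ∀ {w} → Good w → w L.∈ words
  ∈-words⁺ g = ∈-filter⁺ good? (unique-∈-boundedLists (proj₁ g)) g

  ∈-words⁻ : ∀ {w} → w L.∈ words → Good w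
  ∈-words⁻ w∈ = proj₂ (∈-filter⁻ good? {xs = boundedLists n} w∈)

  -- Witness that words exist; it is also the word exhibited when there is only one.
  greedyWord : List (Fin n)
  greedyWord = filter free? (allFin n) ++ filter dependent? (allFin n)

  greedyWord-good : Good greedyWord
  greedyWord-good = ++⁺ (filter⁺ free? (allFin⁺ n)) (filter⁺ dependent? (allFin⁺ n)) disjoint
                  , (λ x → sound , complete) , supp
    where
    as = filter free? (allFin n)
    bs = filter dependent? (allFin n)
    ∈as⇒free : ∀ {x} → x L.∈ as → Free x
    ∈as⇒free x∈as = proj₂ (∈-filter⁻ free? {xs = allFin n} x∈as)
    ∈bs⇒dependent : ∀ {x} → x L.∈ bs → Dependent x
    ∈bs⇒dependent x∈bs = proj₂ (∈-filter⁻ dependent? {xs = allFin n} x∈bs)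
    disjoint : ∀ {x} → ¬ (x L.∈ as × x L.∈ bs)
    disjoint (x∈as , x∈bs) =
      proj₂ (∈bs⇒dependent x∈bs) (∈as⇒free x∈as)
    sound : ∀ {x} → x L.∈ as ++ bs → x ≢ s
    sound x∈ with ∈-++⁻ as x∈
    ... | inj₁ x∈as = free≢s (∈as⇒free x∈as)
    ... | inj₂ x∈bs = proj₁ (∈bs⇒dependent x∈bs)
    complete : ∀ {x} → x ≢ s → x L.∈ as ++ bs
    complete {x} x≢s with free? x
    ... | yes fx = ∈-++⁺ˡ (∈-filter⁺ free? (∈-allFin x) fx)
    ... | no ¬fx = ∈-++⁺ʳ as (∈-filter⁺ dependent? (∈-allFin x) (x≢s , ¬fx))
    supp : ∀ y → y ≢ s → Supported y (as ++ bs)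
    supp y y≢s with free? y
    ... | yes fy = inj₁ fy
    ... | no ¬fy with hasNeighbour y≢s ¬fy
    ...   | u , Nyu = inj₂ (u , Nyu , before (ℕ.<-≤-trans
            (pos-++ˡ as bs (∈-filter⁺ free? (∈-allFin u) (N⇒free Nyu)))
            (pos-++ʳ as bs (¬fy ∘ ∈as⇒free))))

  c : Fin n → Fin n → ℕ
  c x y = count (before? x y) words

  c-total : ∀ {x y} → x ≢ y → x ≢ s → length words ≡ c x y + c y x
  c-total x≢y x≢s = count-partition (before? _ _) (before? _ _) words
    (λ w∈ → before-total x≢y (good-∈ (∈-words⁻ w∈) x≢s)) before-asym

  -- Equivalent to 1/3 ≤ Pr[x<y] ≤ 2/3, since c x y + c y x is the number of words.
  BalancedCounts : Fin n → Fin n → Set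
  BalancedCounts x y = c y x ≤ 2 * c x y × c x y ≤ 2 * c y x

  HasBalancedPair : Set
  HasBalancedPair = ∃[ x ] ∃[ y ] (x ≢ y × x ≢ s × y ≢ s × BalancedCounts x y)

  OneWord : Set
  OneWord = ∃[ w ] (Good w × (∀ w′ → Good w′ → w′ ≡ w))

  -- Relabelling words by involutions.

  record Involution : Set where
    field
      σ          : Fin n → Fin n
      involutive : ∀ x → σ (σ x) ≡ x
      fixes-s    : σ s ≡ s

    injective : ∀ {x y} → σ x ≡ σ y → x ≡ y
    injective {x} {y} eq = trans (sym (involutive x)) (trans (cong σ eq) (involutive y))

    ≢s : ∀ {x} → x ≢ s → σ x ≢ s
    ≢s x≢s σx≡s = x≢s (injective (trans σx≡s (sym fixes-s)))

    -- As `x` is `σ (σ x)`, its occurrences in `map σ w` come from those of `σ x` in `w`, and order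
    -- in the new word is read off the old one without a separate inverse.
    pos-relabel : ∀ x w → pos x (map σ w) ≡ pos (σ x) w
    pos-relabel x w = trans (cong (λ z → pos z (map σ w)) (sym (involutive x))) (pos-map injective (σ x) w)

    before-relabel : ∀ {x y w} → Before (σ x) (σ y) w → Before x y (map σ w)
    before-relabel {x} {y} {w} (before lt) =
      before (subst₂ _<_ (sym (pos-relabel x w)) (sym (pos-relabel y w)) lt)

    -- The support condition for `map σ w`, pulled back to `w`. It is the only part of `Good` that
    -- relabelling can destroy.
    SupportedAfter : List (Fin n) → Set
    SupportedAfter w = ∀ {y} → Dependent y → ∃[ u ] (N y u × Before (σ u) (σ y) w)

    good-relabel : ∀ {w} → Good w → SupportedAfter w → Good (map σ w)
    good-relabel {w} g@(w! , mem , _) after = map⁺ injective w! , (λ x → sound , complete) , supp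
      where
      sound : ∀ {x} → x L.∈ map σ w → x ≢ s
      sound x∈ with ∈-map⁻ σ x∈
      ... | z , z∈w , refl = ≢s (proj₁ (mem z) z∈w)
      complete : ∀ {x} → x ≢ s → x L.∈ map σ w
      complete {x} x≢s = subst (L._∈ map σ w) (involutive x) (∈-map⁺ σ (good-∈ g (≢s x≢s)))
      supp : ∀ y → y ≢ s → Supported y (map σ w)
      supp y y≢s with free? y
      ... | yes fy = inj₁ fy
      ... | no ¬fy with after (y≢s , ¬fy)
      ...   | u , Nyu , lt = inj₂ (u , Nyu , before-relabel lt)

    -- `map σ` is injective on lists, so it suffices that it sends good words satisfying `P` to good
    -- words satisfying `Q`. All injections of words below are instances.
    count-relabel : ∀ {P Q} (P? : Decidable P) (Q? : Decidable Q) →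
                    (∀ {w} → Good w → P w → SupportedAfter w × Q (map σ w)) →
                    count P? words ≤ count Q? words
    count-relabel P? Q? P⇒Q = count-inject P? Q? (map σ) (map-injective injective) words-unique
      λ w∈ pw → let g = ∈-words⁻ w∈ ; (after , q) = P⇒Q g pw in ∈-words⁺ (good-relabel g after) , q

    -- Relabelling by an automorphism keeps every word good and reverses the order of `x` and `y`,
    -- so both orders are equally frequent.
    automorphism⇒balanced : (∀ {y} → Free y → Free (σ y)) →
      (∀ {y u} → Dependent y → N y u → N (σ y) (σ u)) →
      ∀ {x y} → x ≢ s → σ x ≡ y → x ≢ y → HasBalancedPair
    automorphism⇒balanced σ-free σ-N {x} {y} x≢s σx≡y x≢y =
      x , y , x≢y , x≢s , subst (_≢ s) σx≡y (≢s x≢s) ,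
      m≤n⇒m≤2*n (swapped σy≡x σx≡y) , m≤n⇒m≤2*n (swapped σx≡y σy≡x)
      where
      σy≡x : σ y ≡ x
      σy≡x = trans (cong σ (sym σx≡y)) (involutive x)
      after : ∀ {w} → Good w → SupportedAfter w
      after g {y} (y≢s , ¬fy) with good-support g (≢s y≢s , λ fσy → ¬fy (subst Free (involutive y) (σ-free fσy)))
      ... | u , Nσyu , lt =
        -- `σ y` is dependent as well; the image under `σ` of its support is a support of `y`.
        σ u , subst (λ z → N z (σ u)) (involutive y)
                (σ-N (≢s y≢s , λ fσy → ¬fy (subst Free (involutive y) (σ-free fσy))) Nσyu) ,
        before-cong (involutive u) refl lt
      swapped : ∀ {x y} → σ x ≡ y → σ y ≡ x → c x y ≤ c y x
      swapped σx≡y σy≡x = count-relabel (before? _ _) (before? _ _)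
        λ g lt → after g , before-relabel (before-cong σy≡x σx≡y lt)

  -- Exchanging a dependent vertex with its neighbour or with another dependent vertex.

  transposition : ∀ {a b} → a ≢ s → b ≢ s → Involution
  transposition {a} {b} a≢s b≢s = record
    { σ          = swap a b
    ; involutive = swap-involutive a b
    ; fixes-s    = swap-other (a≢s ∘ sym) (b≢s ∘ sym)
    }

  -- Exchanging `y` and `k` in a word with `y` before `k` moves `k` forward, so vertices supported
  -- by `k` stay supported, and puts `y` behind `k`. Other supports are free vertices different from
  -- `k`, hence are not moved.
  dependent-before-neighbour≤ : ∀ {y k} → Dependent y → N y k → c y k ≤ c k y
  dependent-before-neighbour≤ {y} {k} dy Nyk = count-relabel (before? _ _) (before? _ _) λ g y<k →
    after g y<k , before-relabel (before-cong (swap-right y k) (swap-left y k) y<k)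
    where
    open Involution (transposition (proj₁ dy) (free≢s (N⇒free Nyk)))
    after : ∀ {w} → Good w → Before y k w → SupportedAfter w
    after g y<k {z} dz with z ≟ y
    ... | yes refl = k , Nyk , before-cong (swap-right y k) (swap-left y k) y<k
    ... | no z≢y with good-support g dz
    ...   | u , Nzu , u<z with u ≟ k
    ...     | yes refl = u , Nzu , before-cong (swap-right y k)
                (swap-other z≢y (free≢dependent (N⇒free Nyk) dz ∘ sym)) (before-trans y<k u<z)
    ...     | no u≢k = u , Nzu , before-cong (swap-other (free≢dependent (N⇒free Nzu) dy) u≢k)
                (swap-other z≢y (free≢dependent (N⇒free Nyk) dz ∘ sym)) u<z

  -- Once a common neighbour has been visited, y and y′ may be exchanged.
  common-neighbour-count : ∀ {y y′ k} → Dependent y → Dependent y′ → y ≢ y′ → N y k → N y′ k →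
                           c k y ≤ 2 * c y′ y
  common-neighbour-count {y} {y′} {k} dy dy′ y≢y′ Nyk Ny′k = begin
    -- In a word with `k` before `y`, the vertex `y′` comes after or before `y`; words of the first
    -- kind are mapped injectively into those with `y′` before `y`, whence the factor 2.
    c k y                                 ≤⟨ count-cover (before? k y) kyy′? (before? y′ y) words split ⟩
    count kyy′? words + c y′ y            ≤⟨ ℕ.+-monoˡ-≤ (c y′ y) (count-relabel kyy′? (before? y′ y) exchange) ⟩
    c y′ y + c y′ y                       ≡⟨ cong (c y′ y +_) (ℕ.+-identityʳ (c y′ y)) ⟨
    2 * c y′ y                            ∎
    where
    open ℕ.≤-Reasoning
    open Involution (transposition (proj₁ dy) (proj₁ dy′))
    kyy′? = λ w → before? k y w ×-dec before? y y′ w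
    split : ∀ {w} → w L.∈ words → Before k y w → (Before k y w × Before y y′ w) ⊎ Before y′ y w
    split w∈ k<y = Sum.map (k<y ,_) id (before-total y≢y′ (good-∈ (∈-words⁻ w∈) (proj₁ dy)))
    fixes-free : ∀ {u} → Free u → σ u ≡ u
    fixes-free fu = swap-other (free≢dependent fu dy) (free≢dependent fu dy′)
    exchange : ∀ {w} → Good w → Before k y w × Before y y′ w → SupportedAfter w × Before y′ y (map σ w)
    exchange {w} g (k<y , y<y′) =
      after , before-relabel (before-cong (swap-right y y′) (swap-left y y′) y<y′)
      where
      after : SupportedAfter w
      -- Both exchanged places lie after that of `k`, so `k` supports `y` and `y′` in the new word.
      after {z} dz with z ≟ y | z ≟ y′
      ... | yes refl | _        =
        k , Nyk , before-cong (fixes-free (N⇒free Nyk)) (swap-left y y′) (before-trans k<y y<y′)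
      ... | no _     | yes refl =
        k , Ny′k , before-cong (fixes-free (N⇒free Nyk)) (swap-right y y′) k<y
      ... | no z≢y   | no z≢y′ with good-support g dz
      ...   | u , Nzu , u<z =
        u , Nzu , before-cong (fixes-free (N⇒free Nzu)) (swap-other z≢y z≢y′) u<z

  -- By symmetry let `y′` precede `y` in at most half of the words. Either `k` and `y` are balanced,
  -- or `y` precedes `k` so rarely that the bound on `c k y` by `2 * c y′ y` also controls `c y y′`.
  common-neighbour⇒balanced : ∀ {y y′ k} → Dependent y → Dependent y′ → y ≢ y′ → N y k → N y′ k →
                              HasBalancedPair
  common-neighbour⇒balanced {k = k} dy dy′ y≢y′ Nyk Ny′k =
    [ wlog dy dy′ y≢y′ Nyk Ny′k , wlog dy′ dy (y≢y′ ∘ sym) Ny′k Nyk ]′ (ℕ.≤-total _ _)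
    where
    fk = N⇒free Nyk
    wlog : ∀ {y y′} → Dependent y → Dependent y′ → y ≢ y′ → N y k → N y′ k →
           c y′ y ≤ c y y′ → HasBalancedPair
    wlog {y} {y′} dy dy′ y≢y′ Nyk Ny′k y′y≤yy′ with c k y ≤? 2 * c y k
    ... | yes ky≤2yk =
      k , y , free≢dependent fk dy , free≢s fk , proj₁ dy , m≤n⇒m≤2*n (dependent-before-neighbour≤ dy Nyk) , ky≤2yk
    ... | no ky≰2yk =
      y , y′ , y≢y′ , proj₁ dy , proj₁ dy′ , m≤n⇒m≤2*n y′y≤yy′ ,
      balanced-arith (c y′ y) (c y y′) (c k y) (c y k) totals
        (common-neighbour-count dy dy′ y≢y′ Nyk Ny′k) (ℕ.<⇒≤ (ℕ.≰⇒> ky≰2yk))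
      where
      totals : c y′ y + c y y′ ≡ c k y + c y k
      totals = trans (sym (c-total (y≢y′ ∘ sym) (proj₁ dy′))) (c-total (free≢dependent fk dy) (free≢s fk))

  -- Balance and uniqueness when neighbourhoods are disjoint.

  DisjointNeighbourhoods : Set
  DisjointNeighbourhoods = ∀ {y y′ k} → Dependent y → Dependent y′ → N y k → N y′ k → y ≡ y′

  SingletonNeighbourhoods : Set
  SingletonNeighbourhoods = ∀ {y a b} → Dependent y → N y a → N y b → a ≡ b

  -- By disjointness `y` is the only dependent vertex with `a` or `b` in its neighbourhood, and it
  -- has both, so their transposition is an automorphism.
  two-neighbours⇒balanced : DisjointNeighbourhoods →
    ∀ {y a b} → Dependent y → N y a → N y b → a ≢ b → HasBalancedPair
  two-neighbours⇒balanced disjoint {y} {a} {b} dy Nya Nyb a≢b =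
    automorphism⇒balanced (swap-preserves Free fa fb) preserves a≢s (swap-left a b) a≢b
    where
    fa = N⇒free Nya
    fb = N⇒free Nyb
    a≢s = free≢s fa
    open Involution (transposition a≢s (free≢s fb))
    preserves : ∀ {z u} → Dependent z → N z u → N (swap a b z) (swap a b u)
    preserves {z} {u} dz Nzu = subst (λ v → N v (swap a b u))
      (sym (swap-other (free≢dependent fa dz ∘ sym) (free≢dependent fb dz ∘ sym))) neighbour
      where
      neighbour : N z (swap a b u)
      neighbour with u ≟ a | u ≟ b
      ... | yes refl | _ rewrite swap-left a b | disjoint dz dy Nzu Nya = Nyb
      ... | no _ | yes refl rewrite swap-right a b | disjoint dz dy Nzu Nyb = Nya
      ... | no u≢a | no u≢b rewrite swap-other u≢a u≢b = Nzu

  -- The automorphism exchanges `y` with `y′` and their unique neighbours `k` with `k′`; no other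
  -- dependent vertex has `k` or `k′` as a neighbour.
  two-stars⇒balanced : DisjointNeighbourhoods →
    SingletonNeighbourhoods →
    ∀ {y y′} → Dependent y → Dependent y′ → y ≢ y′ → HasBalancedPair
  two-stars⇒balanced disjoint single {y} {y′} dy dy′ y≢y′ =
    automorphism⇒balanced
      (λ fx → subst Free (sym (flip-free fx)) (swap-preserves Free fk fk′ fx))
      preserves (proj₁ dy) (trans (flip-nonfree (proj₂ dy)) (swap-left y y′)) y≢y′
    where
    k = proj₁ (hasNeighbour (proj₁ dy) (proj₂ dy))
    Nyk = proj₂ (hasNeighbour (proj₁ dy) (proj₂ dy))
    k′ = proj₁ (hasNeighbour (proj₁ dy′) (proj₂ dy′))
    Ny′k′ = proj₂ (hasNeighbour (proj₁ dy′) (proj₂ dy′))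
    fk = N⇒free Nyk
    fk′ = N⇒free Ny′k′
    -- Free and non-free vertices are treated separately, so the two transpositions do not interact
    -- and involutivity needs no comparison among the four vertices.
    flip : Fin n → Fin n
    flip x with free? x
    ... | yes _ = swap k k′ x
    ... | no  _ = swap y y′ x
    flip-free : ∀ {x} → Free x → flip x ≡ swap k k′ x
    flip-free {x} fx with free? x
    ... | yes _  = refl
    ... | no ¬fx = contradiction fx ¬fx
    flip-nonfree : ∀ {x} → ¬ Free x → flip x ≡ swap y y′ x
    flip-nonfree {x} ¬fx with free? x
    ... | yes fx = contradiction fx ¬fx
    ... | no  _  = refl
    flip-involutive : ∀ x → flip (flip x) ≡ x
    flip-involutive x with free? x
    ... | yes fx = trans (flip-free (swap-preserves Free fk fk′ fx)) (swap-involutive k k′ x)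
    ... | no ¬fx = trans (flip-nonfree (swap-preserves (¬_ ∘ Free) (proj₂ dy) (proj₂ dy′) ¬fx))
                         (swap-involutive y y′ x)
    exchange : Involution
    exchange = record
      { σ          = flip
      ; involutive = flip-involutive
      ; fixes-s    = trans (flip-nonfree ¬free-s) (swap-other (proj₁ dy ∘ sym) (proj₁ dy′ ∘ sym))
      }
    open Involution exchange
    preserves-swap : ∀ {z u} → Dependent z → N z u → N (swap y y′ z) (swap k k′ u)
    preserves-swap {z} {u} dz Nzu with z ≟ y | z ≟ y′
    ... | yes refl | _ rewrite swap-left y y′ | single dy Nzu Nyk | swap-left k k′ = Ny′k′
    ... | no _ | yes refl rewrite swap-right y y′ | single dy′ Nzu Ny′k′ | swap-right k k′ = Nyk
    ... | no z≢y | no z≢y′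
      rewrite swap-other z≢y z≢y′
            | swap-other {a = k} {k′} {u} (λ { refl → z≢y (disjoint dz dy Nzu Nyk) })
                (λ { refl → z≢y′ (disjoint dz dy′ Nzu Ny′k′) }) = Nzu
    preserves : ∀ {z u} → Dependent z → N z u → N (flip z) (flip u)
    preserves dz Nzu = subst₂ N (sym (flip-nonfree (proj₂ dz))) (sym (flip-free (N⇒free Nzu)))
                                (preserves-swap dz Nzu)

  -- Each of the events i < k, k < i < y, y < i is mapped injectively into the preceding one.
  star-and-point⇒balanced : ∀ {y k i} → Dependent y → (∀ {z} → Dependent z → z ≡ y) →
    N y k → (∀ {u} → N y u → u ≡ k) → Free i → i ≢ k → HasBalancedPair
  star-and-point⇒balanced {y} {k} {i} dy only-y Nyk only-k fi i≢k =
    i , k , i≢k , i≢s , k≢s , ki≤2ik , m≤n⇒m≤2*n ik≤ki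
    where
    i≢s = free≢s fi
    k≢s = free≢s (N⇒free Nyk)
    i≢y = free≢dependent fi dy
    k≢y = free≢dependent (N⇒free Nyk) dy
    kiy? = λ w → before? k i w ×-dec before? i y w
    module I↔K = Involution (transposition i≢s k≢s)
    module I↔Y = Involution (transposition i≢s (proj₁ dy))
    fixes-y : swap i k y ≡ y
    fixes-y = swap-other (i≢y ∘ sym) (k≢y ∘ sym)
    fixes-k : swap i y k ≡ k
    fixes-k = swap-other (i≢k ∘ sym) k≢y
    k<y : ∀ {w} → Good w → Before k y w
    k<y g with good-support g dy
    ... | u , Nyu , u<y = before-cong (sym (only-k Nyu)) refl u<y
    -- After the exchange `k` has the place of `i`, so it supports `y` as soon as `i` preceded `y`.
    I↔K-after : ∀ {w} → Before i y w → I↔K.SupportedAfter w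
    I↔K-after i<y {z} dz with only-y dz
    ... | refl = k , Nyk , before-cong (swap-right i k) fixes-y i<y
    -- Here `y` moves to a later place, so `k` still precedes it.
    I↔Y-after : ∀ {w} → Good w → Before y i w → I↔Y.SupportedAfter w
    I↔Y-after g y<i {z} dz with only-y dz
    ... | refl = k , Nyk , before-cong fixes-k (swap-right i y) (before-trans (k<y g) y<i)
    ik≤ki : c i k ≤ c k i
    ik≤ki = I↔K.count-relabel (before? i k) (before? k i) λ g i<k →
      I↔K-after (before-trans i<k (k<y g)) ,
      I↔K.before-relabel (before-cong (swap-right i k) (swap-left i k) i<k)
    kiy≤ik : count kiy? words ≤ c i k
    kiy≤ik = I↔K.count-relabel kiy? (before? i k) λ g (k<i , i<y) →
      I↔K-after i<y , I↔K.before-relabel (before-cong (swap-left i k) (swap-right i k) k<i)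
    yi≤kiy : c y i ≤ count kiy? words
    yi≤kiy = I↔Y.count-relabel (before? y i) kiy? λ g y<i →
      I↔Y-after g y<i ,
      I↔Y.before-relabel (before-cong fixes-k (swap-left i y) (k<y g)) ,
      I↔Y.before-relabel (before-cong (swap-left i y) (swap-right i y) y<i)
    ki≤2ik : c k i ≤ 2 * c i k
    ki≤2ik = begin
      c k i                     ≤⟨ count-cover (before? k i) kiy? (before? y i) words
                                     (λ w∈ k<i → Sum.map (k<i ,_) id
                                       (before-total i≢y (good-∈ (∈-words⁻ w∈) i≢s))) ⟩
      count kiy? words + c y i  ≤⟨ ℕ.+-mono-≤ kiy≤ik (ℕ.≤-trans yi≤kiy kiy≤ik) ⟩
      c i k + c i k             ≡⟨ cong (c i k +_) (ℕ.+-identityʳ (c i k)) ⟨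
      2 * c i k                 ∎
      where open ℕ.≤-Reasoning

  all-free⇒balanced : (∀ {y} → ¬ Dependent y) → ∀ {a b} → a ≢ s → b ≢ s → a ≢ b → HasBalancedPair
  all-free⇒balanced none {a} {b} a≢s b≢s a≢b =
    automorphism⇒balanced (λ fy → free (≢s (free≢s fy))) (λ dy → contradiction dy none)
      a≢s (swap-left a b) a≢b
    where
    open Involution (transposition a≢s b≢s)
    free : ∀ {x} → x ≢ s → Free x
    free {x} x≢s with free? x
    ... | yes fx = fx
    ... | no ¬fx = contradiction (x≢s , ¬fx) none

  -- Every word orders each pair as `greedyWord` does, and a duplicate-free list is determined by
  -- its entries and their order.
  rigid⇒oneWord : (∀ {x y} → x ≢ s → y ≢ s → x ≢ y →
                    (∀ {w} → Good w → Before x y w) ⊎ (∀ {w} → Good w → Before y x w)) → OneWord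
  rigid⇒oneWord rigid = greedyWord , greedyWord-good , unique
    where
    unique : ∀ w → Good w → w ≡ greedyWord
    unique w g@(w! , mem , _) = unique-order-determines w! (proj₁ greedyWord-good)
      (λ x∈w → good-∈ greedyWord-good (proj₁ (mem _) x∈w))
      (λ x∈ → good-∈ g (proj₁ (proj₁ (proj₂ greedyWord-good) _) x∈)) mono
      where
      mono : ∀ {x y} → x L.∈ w → y L.∈ w → Before x y w → Before x y greedyWord
      mono {x} {y} x∈w y∈w x<y with x ≟ y
      ... | yes refl = contradiction x<y (before-asym x<y)
      ... | no x≢y with rigid (proj₁ (mem _) x∈w) (proj₁ (mem _) y∈w) x≢y
      ...   | inj₁ always-x<y = always-x<y greedyWord-good
      ...   | inj₂ always-y<x = contradiction x<y (before-asym (always-y<x g))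

  -- Case distinction on the neighbourhoods of dependent vertices.

  disjoint-or-balanced : HasBalancedPair ⊎ DisjointNeighbourhoods
  disjoint-or-balanced with any? (λ y → any? λ y′ → any? λ k → ¬? (y ≟ y′) ×-dec
                             dependent? y ×-dec dependent? y′ ×-dec N? y k ×-dec N? y′ k)
  ... | yes (_ , _ , _ , y≢y′ , dy , dy′ , Nyk , Ny′k) =
    inj₁ (common-neighbour⇒balanced dy dy′ y≢y′ Nyk Ny′k)
  ... | no none = inj₂ λ {y} {y′} dy dy′ Nyk Ny′k → decidable-stable (y ≟ y′) λ y≢y′ →
    none (_ , _ , _ , y≢y′ , dy , dy′ , Nyk , Ny′k)

  singleton-or-balanced : DisjointNeighbourhoods → HasBalancedPair ⊎ SingletonNeighbourhoods
  singleton-or-balanced disjoint with any? (λ y → any? λ a → any? λ b → ¬? (a ≟ b) ×-dec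
                                        dependent? y ×-dec N? y a ×-dec N? y b)
  ... | yes (_ , _ , _ , a≢b , dy , Nya , Nyb) = inj₁ (two-neighbours⇒balanced disjoint dy Nya Nyb a≢b)
  ... | no none = inj₂ λ {_} {a} {b} dy Nya Nyb → decidable-stable (a ≟ b) λ a≢b →
    none (_ , _ , _ , a≢b , dy , Nya , Nyb)

  no-dependent⇒balanced : (∀ {y} → ¬ Dependent y) → HasBalancedPair ⊎ OneWord
  no-dependent⇒balanced none
    with any? (λ a → any? λ b → ¬? (a ≟ b) ×-dec ¬? (a ≟ s) ×-dec ¬? (b ≟ s))
  ... | yes (_ , _ , a≢b , a≢s , b≢s) = inj₁ (all-free⇒balanced none a≢s b≢s a≢b)
  -- Fewer than two elements exist, so rigidity holds vacuously.
  ... | no no-pair =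
    inj₂ (rigid⇒oneWord λ x≢s y≢s x≢y → contradiction (_ , _ , x≢y , x≢s , y≢s) no-pair)

  one-dependent⇒balanced : SingletonNeighbourhoods → ∀ {y} → Dependent y →
    (∀ {z} → Dependent z → z ≡ y) → HasBalancedPair ⊎ OneWord
  one-dependent⇒balanced single {y} dy only-y with hasNeighbour (proj₁ dy) (proj₂ dy)
  ... | k , Nyk with any? (λ i → ¬? (i ≟ s) ×-dec ¬? (i ≟ y) ×-dec ¬? (i ≟ k))
  ...   | yes (i , i≢s , i≢y , i≢k) =
    inj₁ (star-and-point⇒balanced dy only-y Nyk (λ Nyu → single dy Nyu Nyk) free-i i≢k)
    where
    free-i : Free i
    free-i = decidable-stable (free? i) λ ¬fi → i≢y (only-y (i≢s , ¬fi))
  -- The elements are just `k` and `y`, and `k` has to come first.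
  ...   | no no-third = inj₂ (rigid⇒oneWord rigid)
    where
    y-or-k : ∀ {x} → x ≢ s → x ≡ y ⊎ x ≡ k
    y-or-k {x} x≢s with x ≟ y | x ≟ k
    ... | yes x≡y | _       = inj₁ x≡y
    ... | no _    | yes x≡k = inj₂ x≡k
    ... | no x≢y  | no x≢k  = contradiction (x , x≢s , x≢y , x≢k) no-third
    k<y : ∀ {w} → Good w → Before k y w
    k<y g with good-support g dy
    ... | u , Nyu , u<y = before-cong (single dy Nyk Nyu) refl u<y
    rigid : ∀ {x z} → x ≢ s → z ≢ s → x ≢ z →
            (∀ {w} → Good w → Before x z w) ⊎ (∀ {w} → Good w → Before z x w)
    rigid x≢s z≢s x≢z with y-or-k x≢s | y-or-k z≢s
    ... | inj₁ refl | inj₁ refl = contradiction refl x≢z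
    ... | inj₁ refl | inj₂ refl = inj₂ k<y
    ... | inj₂ refl | inj₁ refl = inj₁ k<y
    ... | inj₂ refl | inj₂ refl = contradiction refl x≢z

  balancedPair-or-oneWord : HasBalancedPair ⊎ OneWord
  balancedPair-or-oneWord with disjoint-or-balanced
  ... | inj₁ pair = inj₁ pair
  ... | inj₂ disjoint with singleton-or-balanced disjoint
  ...   | inj₁ pair = inj₁ pair
  ...   | inj₂ single with any? dependent?
  ...     | no none = no-dependent⇒balanced λ dy → none (_ , dy)
  ...     | yes (y , dy) with any? (λ z → ¬? (z ≟ y) ×-dec dependent? z)
  ...       | yes (z , z≢y , dz) = inj₁ (two-stars⇒balanced disjoint single dz dy z≢y)
  ...       | no none = one-dependent⇒balanced single dy λ {z} dz →
    decidable-stable (z ≟ y) λ z≢y → none (z , z≢y , dz)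

-- Auxiliary facts on small sets, removal and walks.

three-of-two : ∀ {A : Set} {P : A → Set} {a b : A} → (∀ {z} → P z → z ≡ a ⊎ z ≡ b) →
  ∀ {x y z} → P x → P y → P z → x ≢ y → x ≢ z → y ≢ z → ⊥
three-of-two cover px py pz x≢y x≢z y≢z with cover px | cover py | cover pz
... | inj₁ refl | inj₁ refl | _         = x≢y refl
... | inj₁ refl | inj₂ refl | inj₁ refl = x≢z refl
... | inj₁ refl | inj₂ refl | inj₂ refl = y≢z refl
... | inj₂ refl | inj₂ refl | _         = x≢y refl
... | inj₂ refl | inj₁ refl | inj₂ refl = x≢z refl
... | inj₂ refl | inj₁ refl | inj₁ refl = y≢z refl

x∉p-x : ∀ {n} (p : Subset n) x → x ∉ p - x
x∉p-x (_ ∷ p) (suc x) (there x∈) = x∉p-x p x x∈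

walk-start : ∀ {n} {G : Graph n} {S u v} → WalkIn G S u v → u ∈ S
walk-start (here u∈S)     = u∈S
walk-start (step u∈S _ _) = u∈S

walk-++ : ∀ {n} {G : Graph n} {S u v w} → WalkIn G S u v → WalkIn G S v w → WalkIn G S u w
walk-++ (here _)          q = q
walk-++ (step u∈S u~v p) q = step u∈S u~v (walk-++ p q)

-- Feasible sets and basic words of a split graph.

module SplitGraph {n : ℕ} (G : Graph n) (K : Subset n) (s : Fin n)
  (connected : Connected G) (split : IsSplitPartition G K) (s∈K : s ∈ K) where

  private
    _~_ : Fin n → Fin n → Set
    _~_ = Adj G

    E = NSGround G s
    F = NSFeasible G s

    ~-sym : ∀ {u v} → u ~ v → v ~ u
    ~-sym {u} {v} u~v = trans (Graph.sym G v u) u~v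

    ~-irrefl : ∀ {u} → ¬ (u ~ u)
    ~-irrefl {u} u~u with () ← trans (sym (Graph.irref G u)) u~u

    _~?_ : ∀ u v → Dec (u ~ v)
    u ~? v = Graph.adj G u v Bool.≟ true

  Free : Fin n → Set
  Free y = y ~ s

  -- The second factor restricts to free neighbours, so that a support never needs a support itself.
  N : Fin n → Fin n → Set
  N y u = y ~ u × u ~ s

  clique-free : ∀ {v} → v ∈ K → v ≢ s → Free v
  clique-free v∈K v≢s = proj₁ split _ s v∈K s∈K v≢s

  -- Only the first step of the walk matters: a vertex outside `K` steps into `K`, and every vertex
  -- of `K` other than `s` is adjacent to `s`. It is applied to walks in the whole graph and in
  -- `T ∪ ⁅ s ⁆` alike.
  walk⇒support : ∀ {S y} → y ≢ s → WalkIn G S y s → Free y ⊎ ∃[ u ] (u ∈ S × N y u)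
  walk⇒support y≢s (here _) = contradiction refl y≢s
  walk⇒support {y = y} y≢s (step {v = v} _ y~v p) with v ≟ s | v ∈? K | y ∈? K
  ... | yes refl | _       | _       = inj₁ y~v
  ... | no _     | _       | yes y∈K = inj₁ (clique-free y∈K y≢s)
  ... | no v≢s   | yes v∈K | no _    = inj₂ (v , walk-start p , y~v , clique-free v∈K v≢s)
  ... | no _     | no v∉K  | no y∉K  = contradiction y~v (proj₂ split _ _ y∉K v∉K)

  hasNeighbour : ∀ {y} → y ≢ s → ¬ Free y → ∃ (N y)
  hasNeighbour {y} y≢s ¬fy with walk⇒support y≢s (connected y s)
  ... | inj₁ fy            = contradiction fy ¬fy
  ... | inj₂ (u , _ , Nyu) = u , Nyu

  open Words s Free N (_~? s) (λ y u → (y ~? u) ×-dec (u ~? s)) ~-irrefl proj₂ hasNeighbour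

  ∈ground⇒≢s : ∀ {x} → x ∈ E → x ≢ s
  ∈ground⇒≢s x∈E = x∉⁅y⁆⇒x≢y (x∈∁p⇒x∉p x∈E)

  ≢s⇒∈ground : ∀ {x} → x ≢ s → x ∈ E
  ≢s⇒∈ground x≢s = x∉p⇒x∈∁p (x≢y⇒x∉⁅y⁆ x≢s)

  -- Local form of feasibility: connectedness of `T ∪ ⁅ s ⁆` becomes a condition on each vertex of
  -- `T` separately.
  Closed : Subset n → Set
  Closed T = (∀ {t} → t ∈ T → t ≢ s) × (∀ {t} → t ∈ T → Free t ⊎ ∃[ u ] (u ∈ T × N t u))

  feasible⇒closed : ∀ {T} → F T → Closed T
  feasible⇒closed {T} (T⊆E , conn) = (∈ground⇒≢s ∘ T⊆E) , support
    where
    support : ∀ {t} → t ∈ T → Free t ⊎ ∃[ u ] (u ∈ T × N t u)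
    support t∈T with walk⇒support (∈ground⇒≢s (T⊆E t∈T))
                       (conn _ s (x∈p∪q⁺ (inj₁ t∈T)) (x∈p∪q⁺ (inj₂ (x∈⁅x⁆ s))))
    ... | inj₁ ft = inj₁ ft
    ... | inj₂ (u , u∈ , Ntu) with x∈p∪q⁻ T ⁅ s ⁆ u∈
    ...   | inj₁ u∈T = inj₂ (u , u∈T , Ntu)
    ...   | inj₂ u∈s = contradiction (x∈⁅y⁆⇒x≡y s u∈s) (free≢s (proj₂ Ntu))

  -- Every vertex of `T ∪ ⁅ s ⁆` reaches `s` in at most two steps, and walks are joined at `s`.
  closed⇒feasible : ∀ {T} → Closed T → F T
  closed⇒feasible {T} (≢s , support) =
    (≢s⇒∈ground ∘ ≢s) , λ u v u∈ v∈ → walk-++ (proj₁ (via-s u∈)) (proj₂ (via-s v∈))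
    where
    S = T ∪ ⁅ s ⁆
    s∈S : s ∈ S
    s∈S = x∈p∪q⁺ (inj₂ (x∈⁅x⁆ s))
    T⊆S : ∀ {t} → t ∈ T → t ∈ S
    T⊆S t∈T = x∈p∪q⁺ (inj₁ t∈T)
    via-s : ∀ {u} → u ∈ S → WalkIn G S u s × WalkIn G S s u
    via-s u∈ with x∈p∪q⁻ T ⁅ s ⁆ u∈
    ... | inj₂ u∈s with refl ← x∈⁅y⁆⇒x≡y s u∈s = here u∈ , here u∈
    ... | inj₁ u∈T with support u∈T
    ...   | inj₁ u~s = step u∈ u~s (here s∈S) , step s∈S (~-sym u~s) (here u∈)
    ...   | inj₂ (v , v∈T , u~v , v~s) =
      step u∈ u~v (step (T⊆S v∈T) v~s (here s∈S)) ,
      step s∈S (~-sym v~s) (step (T⊆S v∈T) (~-sym u~v) (here u∈))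

  private
    Basic : List (Fin n) → Set
    Basic = BasicWord E F

  basic⇒good : ∀ {w} → Basic w → Good w
  basic⇒good {w} (w! , mem , feas) =
    w! , (λ x → (∈ground⇒≢s ∘ to (mem x)) , (from (mem x) ∘ ≢s⇒∈ground)) , supported
    where
    supported : ∀ y → y ≢ s → Supported y w
    -- The prefix of length `suc (pos y w)` is the shortest one containing `y`. The support `u`
    -- found in it is placed no later than `y`, and equal positions would make `y` adjacent to
    -- itself.
    supported y y≢s with proj₂ (feasible⇒closed (feas (suc (pos y w))))
                           (∈-listSet⁺ (pos<⇒∈-take _ w (from (mem y) (≢s⇒∈ground y≢s)) ℕ.≤-refl))
    ... | inj₁ fy = inj₁ fy
    ... | inj₂ (u , u∈ , Nyu) = inj₂ (u , Nyu , before (ℕ.≤∧≢⇒< (s≤s⁻¹ (∈-take⇒pos< _ w u∈take))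
        λ same → ~-irrefl (subst (y ~_) (pos-injective (∈-take⇒∈ _ w u∈take) same) (proj₁ Nyu))))
      where
      u∈take : u L.∈ take (suc (pos y w)) w
      u∈take = ∈-listSet⁻ _ u∈

  -- A support that precedes `t` lies in every prefix that contains `t`.
  good⇒basic : ∀ {w} → Good w → Basic w
  good⇒basic {w} g@(w! , mem , supp) =
    w! , (λ x → mk⇔ (≢s⇒∈ground ∘ proj₁ (mem x)) (proj₂ (mem x) ∘ ∈ground⇒≢s)) ,
    λ k → closed⇒feasible ((λ t∈ → ≢s k (∈-listSet⁻ _ t∈)) , λ t∈ → support k (∈-listSet⁻ _ t∈))
    where
    ≢s : ∀ k {t} → t L.∈ take k w → t ≢ s
    ≢s k t∈ = proj₁ (mem _) (∈-take⇒∈ k w t∈)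
    support : ∀ k {t} → t L.∈ take k w → Free t ⊎ ∃[ u ] (u ∈ listSet (take k w) × N t u)
    support k {t} t∈ with supp t (≢s k t∈)
    ... | inj₁ ft = inj₁ ft
    ... | inj₂ (u , Ntu , before u<t) = inj₂ (u , ∈-listSet⁺
        (pos<⇒∈-take k w (good-∈ g (free≢s (proj₂ Ntu))) (ℕ.<-trans u<t (∈-take⇒pos< k w t∈))) , Ntu)

  enumerates-words : Enumerates E F Basic words
  enumerates-words = words-unique , λ w → mk⇔ (good⇒basic ∘ ∈-words⁻) (∈-words⁺ ∘ basic⇒good)

  -- The condition `y ≢ s` makes `y` occur in each word; an absent vertex has the length of the word
  -- as its position and would count as preceded by every entry.
  enumerates-precedes : ∀ {x y} → y ≢ s →
    Enumerates E F (λ w → Basic w × Precedes E F x y w) (filter (before? x y) words)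
  enumerates-precedes {x} {y} y≢s = filter⁺ (before? x y) words-unique , λ w → mk⇔ sound complete
    where
    sound : ∀ {w} → w L.∈ filter (before? x y) words → Basic w × Precedes E F x y w
    sound {w} w∈ with ∈-filter⁻ (before? x y) {xs = words} w∈
    ... | w∈words , before x<y =
      good⇒basic (∈-words⁻ w∈words) , pos<⇒split w (good-∈ (∈-words⁻ w∈words) y≢s) x<y
    complete : ∀ {w} → Basic w × Precedes E F x y w → w L.∈ filter (before? x y) words
    complete (basic@(w! , _) , a , b , refl , y∈b) =
      ∈-filter⁺ (before? x y) (∈-words⁺ (basic⇒good basic)) (before (split⇒pos< a b w! y∈b))

  balancedPair : ∀ {x y} → x ≢ y → x ≢ s → y ≢ s → BalancedCounts x y → BalancedPair E F x y
  balancedPair {x} {y} x≢y x≢s y≢s (yx≤2xy , xy≤2yx) =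
    words , filter (before? x y) words , enumerates-words , enumerates-precedes y≢s ,
    ∈-length (∈-words⁺ greedyWord-good) ,
    (begin
      length words          ≡⟨ c-total x≢y x≢s ⟩
      c x y + c y x         ≤⟨ ℕ.+-monoʳ-≤ (c x y) yx≤2xy ⟩
      3 * c x y             ∎) ,
    (begin
      3 * c x y             ≡⟨ ℕ.+-comm (c x y) (2 * c x y) ⟩
      2 * c x y + c x y     ≤⟨ ℕ.+-monoʳ-≤ (2 * c x y) xy≤2yx ⟩
      2 * c x y + 2 * c y x ≡⟨ ℕ.*-distribˡ-+ 2 (c x y) (c y x) ⟨
      2 * (c x y + c y x)   ≡⟨ cong (2 *_) (c-total x≢y x≢s) ⟨
      2 * length words      ∎)
    where open ℕ.≤-Reasoning

  balanced : Balanced E F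
  balanced with balancedPair-or-oneWord
  ... | inj₁ (x , y , x≢y , x≢s , y≢s , bal) =
    inj₁ (x , y , x≢y , ≢s⇒∈ground x≢s , ≢s⇒∈ground y≢s , balancedPair x≢y x≢s y≢s bal)
  ... | inj₂ (w , good , unique) = inj₂ (w , good⇒basic good , λ w′ → unique w′ ∘ basic⇒good)

  -- Paths and height.

  remove-closed : ∀ {P z} → Closed P →
    (∀ {t} → t ∈ P → t ≢ z → ¬ Free t → ∃[ u ] (u ∈ P × u ≢ z × N t u)) → Closed (P - z)
  remove-closed {P} {z} (≢s , _) support = (≢s ∘ p─q⊆p P ⁅ z ⁆) , support′
    where
    support′ : ∀ {t} → t ∈ P - z → Free t ⊎ ∃[ u ] (u ∈ P - z × N t u)
    support′ {t} t∈ with t ~? s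
    ... | yes ft = inj₁ ft
    ... | no ¬ft with support (p─q⊆p P ⁅ z ⁆ t∈) (λ { refl → x∉p-x P z t∈ }) ¬ft
    ...   | u , u∈P , u≢z , Ntu = inj₂ (u , x∈p∧x≢y⇒x∈p-y u∈P u≢z , Ntu)

  -- Supports are free, so a non-free element of a path is always removable and hence is `x`. Only
  -- `x` can then need a support, so any element other than a chosen support `b` of `x` is
  -- removable, and equals `x` as well.
  path-elements : ∀ {P} → IsPath E F P → ∃[ a ] ∃[ b ] (∀ {z} → z ∈ P → z ≡ a ⊎ z ≡ b)
  path-elements {P} (feas , x , x∈P , _ , only-x) = x , b , cover
    where
    closed : Closed P
    closed = feasible⇒closed feas
    removable⇒≡x : ∀ {z} → z ∈ P →
      (∀ {t} → t ∈ P → t ≢ z → ¬ Free t → ∃[ u ] (u ∈ P × u ≢ z × N t u)) → z ≡ x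
    removable⇒≡x z∈P support = only-x _ z∈P (closed⇒feasible (remove-closed closed support))
    nonfree⇒≡x : ∀ {z} → z ∈ P → ¬ Free z → z ≡ x
    nonfree⇒≡x {z} z∈P ¬fz = removable⇒≡x z∈P support
      where
      support : ∀ {t} → t ∈ P → t ≢ z → ¬ Free t → ∃[ u ] (u ∈ P × u ≢ z × N t u)
      support t∈P _ ¬ft with proj₂ closed t∈P
      ... | inj₁ ft = contradiction ft ¬ft
      ... | inj₂ (u , u∈P , Ntu) = u , u∈P , (λ { refl → ¬fz (proj₂ Ntu) }) , Ntu
    -- If `x` is free it needs no support, and `b` defaults to `x`; then `cover` leaves `x` alone.
    b : Fin n
    b = [ (λ _ → x) , proj₁ ]′ (proj₂ closed x∈P)
    b-supports : ¬ Free x → b ∈ P × N x b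
    b-supports ¬fx with proj₂ closed x∈P
    ... | inj₁ fx          = contradiction fx ¬fx
    ... | inj₂ (_ , b∈P×N) = b∈P×N
    cover : ∀ {z} → z ∈ P → z ≡ x ⊎ z ≡ b
    cover {z} z∈P with z ≟ b
    ... | yes z≡b = inj₂ z≡b
    ... | no z≢b = inj₁ (removable⇒≡x z∈P support)
      where
      support : ∀ {t} → t ∈ P → t ≢ z → ¬ Free t → ∃[ u ] (u ∈ P × u ≢ z × N t u)
      support t∈P _ ¬ft with refl ← nonfree⇒≡x t∈P ¬ft =
        b , proj₁ (b-supports ¬ft) , z≢b ∘ sym , proj₂ (b-supports ¬ft)

  -- A path is nonempty by its distinguished element, so a strict chain of three would put three
  -- distinct elements into the largest path, which has at most two.
  heightAtMostTwo : HeightAtMostTwo E F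
  heightAtMostTwo (_ , _ , _ , (_ , x , x∈P₁ , _) , _ , path₃ ,
                   (P₁⊆P₂ , y , y∈P₂ , y∉P₁) , (P₂⊆P₃ , z , z∈P₃ , z∉P₂)) =
    three-of-two (proj₂ (proj₂ (path-elements path₃))) (P₂⊆P₃ (P₁⊆P₂ x∈P₁)) (P₂⊆P₃ y∈P₂) z∈P₃
      (λ { refl → y∉P₁ x∈P₁ }) (λ { refl → z∉P₂ (P₁⊆P₂ x∈P₁) }) (λ { refl → z∉P₂ y∈P₂ })

theorem10 : ∀ {n : ℕ} (G : Graph n) (K : Subset n) (s : Fin n) →
    Connected G → IsSplitPartition G K → s ∈ K →
    HeightAtMostTwo (NSGround G s) (NSFeasible G s) ×
    Balanced (NSGround G s) (NSFeasible G s)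
theorem10 G K s connected split s∈K = heightAtMostTwo , balanced
  where open SplitGraph G K s connected split s∈K
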